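{- Let $F$ be a field and let $G$ be a bipartite graph with bipartition $(X,Y)$, where $|X|=m$, $|Y|=n$ and $m\le n$. If $\mathcal{R}_F(G)\neq\emptyset$, then $$f(G\Box K_2)=m.$$
   Context: All graphs are finite and simple. For a graph $H$ with a perfect matching $M$, a subset $S\subseteq M$ is a forcing set of $M$ if $S$ is contained in no other perfect matching of $H$; $f(H,M)$ is the minimum size of a forcing set of $M$, and $f(H)$ is the minimum of $f(H,M)$ over all perfect matchings $M$ of $H$. For a bipartite graph $G$ with bipartition $(X,Y)$, a weighted bi-adjacency matrix of $G$ over $F$ is an $|X|\times|Y|$ matrix over $F$, rows indexed by $X$ and columns by $Y$, whose $(x,y)$ entry is nonzero iff $x$ and $y$ are adjacent. $\mathcal{R}_F(G)$ denotes the set of weighted bi-adjacency matrices $B$ of $G$ over $F$ (rows indexed by $X$, columns by $Y$) for which there is another weighted bi-adjacency matrix $C$ of $G$ over $F$ (rows indexed by $X$, columns by $Y$) with $BC^{\top}=I_m$; so $\mathcal{R}_F(G)\neq\emptyset$ means such a pair $B,C$ exists. $K_2$ is the complete graph on two vertices, and $G\Box H$ is the Cartesian product: vertex set $V(G)\times V(H)$, with $(g_1,h_1)\sim(g_2,h_2)$ iff either $g_1=g_2$ and $h_1h_2\in E(H)$, or $h_1=h_2$ and $g_1g_2\in E(G)$. -}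

module Defs where

open import Level using (0ℓ; _⊔_)
open import Algebra.Apartness.Bundles using (HeytingField; HeytingCommutativeRing)
open import Algebra.Bundles using (CommutativeRing)
import Algebra.Properties.Monoid.Sum
open import Data.Bool.Base using (Bool; T; if_then_else_)
open import Data.Bool.Properties using (T?)
open import Data.Fin.Base as Fin using (Fin)
import Data.Fin.Properties as Fin
open import Data.List.Base using (length; filter; allFin; cartesianProduct)
open import Data.Nat.Base using (ℕ; _*_; _≤_)
open import Data.Product.Base using (∃-syntax; _×_; _,_; proj₂)
  renaming (map to map×)
open import Data.Product using (∃!)
open import Data.Product.Function.NonDependent.Propositional using (_×-↔_)
open import Data.Sum.Base as Sum using (_⊎_; inj₁; inj₂)
open import Function.Base using (_∘_)
open import Function.Bundles using (_↔_; _⇔_; module Inverse)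
open import Function.Construct.Composition using (_↔-∘_)
open import Function.Construct.Identity using (↔-id)
open import Function.Construct.Symmetry using (↔-sym)
open import Function.Properties.Inverse using (↔⇒↣)
open import Relation.Binary.Core using (Rel)
open import Relation.Binary.Definitions using (Decidable; DecidableEquality; Symmetric)
open import Relation.Binary.PropositionalEquality using (_≡_; _≢_; refl; sym)
open import Relation.Nullary.Decidable using (does; _×-dec_; _⊎-dec_; ¬?)
open import Relation.Nullary.Negation using (¬_)
open import Relation.Unary using (Pred)

finite⇒≟ : ∀ {A : Set} {n} → A ↔ Fin n → DecidableEquality A
finite⇒≟ e = Fin.inj⇒≟ (↔⇒↣ e)

-- Finite simple graphs.  The numbering of the vertices witnesses finiteness.

record Graph : Set₁ where
  infix 4 _~_ _~?_ _≟_
  field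
    V      : Set
    order  : ℕ
    index  : V ↔ Fin order
    _~_    : Rel V 0ℓ
    _~?_   : Decidable _~_
    ~-sym  : Symmetric _~_
    ~-irr  : ∀ {v} → ¬ (v ~ v)

  vertex : Fin order → V
  vertex = Inverse.from index

  _≟_ : DecidableEquality V
  _≟_ = finite⇒≟ index

K : ℕ → Graph
K n = record
  { V     = Fin n
  ; order = n
  ; index = ↔-id (Fin n)
  ; _~_   = _≢_
  ; _~?_  = λ i j → ¬? (i Fin.≟ j)
  ; ~-sym = λ i≢j j≡i → i≢j (sym j≡i)
  ; ~-irr = λ i≢i → i≢i refl
  }

infixl 7 _□_

_□_ : Graph → Graph → Graph
G □ H = record
  { V     = G.V × H.V
  ; order = G.order * H.order
  ; index = ↔-sym Fin.*↔× ↔-∘ (G.index ×-↔ H.index)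
  ; _~_   = λ (g₁ , h₁) (g₂ , h₂) →
              (g₁ ≡ g₂ × h₁ H.~ h₂) ⊎ (h₁ ≡ h₂ × g₁ G.~ g₂)
  ; _~?_  = λ (g₁ , h₁) (g₂ , h₂) →
              (g₁ G.≟ g₂ ×-dec h₁ H.~? h₂) ⊎-dec (h₁ H.≟ h₂ ×-dec g₁ G.~? g₂)
  ; ~-sym = Sum.map (map× sym H.~-sym) (map× sym G.~-sym)
  ; ~-irr = Sum.[ H.~-irr ∘ proj₂ , G.~-irr ∘ proj₂ ]
  }
  where
  module G = Graph G
  module H = Graph H

-- A set of (unordered) edges is a symmetric Boolean-valued relation below
-- adjacency.

record EdgeSet (H : Graph) : Set where
  open Graph H
  field
    member     : V → V → Bool
    member-sym : ∀ u v → member u v ≡ member v u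
    member⇒~   : ∀ {u v} → T (member u v) → u ~ v

  _∋_—_ : V → V → Set
  _∋_—_ u v = T (member u v)

  -- Every edge has exactly one orientation (i , j) with i < j in the
  -- numbering of the vertices.
  size : ℕ
  size = length (filter
    (λ (i , j) → (i Fin.<? j) ×-dec T? (member (vertex i) (vertex j)))
    (cartesianProduct (allFin order) (allFin order)))

module _ {H : Graph} where
  open Graph H
  open EdgeSet

  infix 4 _⊆_ _≐_

  _⊆_ : Rel (EdgeSet H) 0ℓ
  S ⊆ M = ∀ {u v} → S ∋ u — v → M ∋ u — v

  _≐_ : Rel (EdgeSet H) 0ℓ
  S ≐ M = S ⊆ M × M ⊆ S

  IsPerfectMatching : Pred (EdgeSet H) 0ℓ
  IsPerfectMatching M = ∀ u → ∃! _≡_ λ v → M ∋ u — v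

  IsForcingSet : EdgeSet H → Pred (EdgeSet H) 0ℓ
  IsForcingSet M S =
    S ⊆ M × (∀ M′ → IsPerfectMatching M′ → S ⊆ M′ → M′ ≐ M)

IsMinimum : Pred ℕ 0ℓ → Pred ℕ 0ℓ
IsMinimum P k = P k × (∀ j → P j → k ≤ j)

-- f(H , M) = k and f(H) = k are rendered as relations, so that a minimum is
-- not computed but characterised: attained, and a lower bound.

IsForcingNumberAt : (H : Graph) → EdgeSet H → ℕ → Set
IsForcingNumberAt H M k =
  IsMinimum (λ s → ∃[ S ] IsForcingSet {H} M S × EdgeSet.size S ≡ s) k

IsForcingNumber : Graph → ℕ → Set
IsForcingNumber H k =
  IsMinimum (λ s → ∃[ M ] IsPerfectMatching {H} M × IsForcingNumberAt H M s) k

-- A bipartition (X , Y) with |X| = m and |Y| = n: the vertex set is the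
-- disjoint union of X and Y, and both parts are independent.

record Bipartition (G : Graph) (m n : ℕ) : Set₁ where
  open Graph G
  field
    X Y     : Set
    X-index : X ↔ Fin m
    Y-index : Y ↔ Fin n
    parts   : (X ⊎ Y) ↔ V

  xᵥ : X → V
  xᵥ = Inverse.to parts ∘ inj₁

  yᵥ : Y → V
  yᵥ = Inverse.to parts ∘ inj₂

  field
    X-indep : ∀ x x′ → ¬ (xᵥ x ~ xᵥ x′)
    Y-indep : ∀ y y′ → ¬ (yᵥ y ~ yᵥ y′)

-- "Nonzero" is apartness from 0#.  Apartness is tight, so an entry that is
-- not apart from 0# equals 0#.

module _ {c ℓ₁ ℓ₂} (F : HeytingField c ℓ₁ ℓ₂)
         {G : Graph} {m n : ℕ} (P : Bipartition G m n) where
  open Graph G using (_~_)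
  open Bipartition P
  open HeytingField F using (Carrier; _≈_; _#_; 0#; 1#; heytingCommutativeRing)
    renaming (_*_ to _·_)
  open CommutativeRing (HeytingCommutativeRing.commutativeRing heytingCommutativeRing)
    using (+-monoid)
  open Algebra.Properties.Monoid.Sum +-monoid using (sum)

  IsWeightedBiadjacency : Pred (X → Y → Carrier) ℓ₂
  IsWeightedBiadjacency B = ∀ x y → (B x y # 0#) ⇔ (xᵥ x ~ yᵥ y)

  _⊛ᵀ_ : (B C : X → Y → Carrier) → X → X → Carrier
  (B ⊛ᵀ C) x x′ = sum λ j →
    let y = Inverse.from Y-index j in B x y · C x′ y

  I : X → X → Carrier
  I x x′ = if does (finite⇒≟ X-index x x′) then 1# else 0#

  𝓡 : Pred (X → Y → Carrier) (c ⊔ ℓ₁ ⊔ ℓ₂)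
  𝓡 B = IsWeightedBiadjacency B ×
        ∃[ C ] IsWeightedBiadjacency C × (∀ x x′ → (B ⊛ᵀ C) x x′ ≈ I x x′)

{-# OPTIONS --safe #-}

-- With weights B and C such that B Cᵀ = I, the matrix W = [ I , B ; Cᵀ , I ] is a
-- weighted bi-adjacency matrix of the prism whose left kernel {(p , -pB)} has
-- dimension m.  If S had fewer than m edges, some nonzero kernel vector would vanish
-- on the rows met by S.  No column of W can have exactly one nonzero term in the
-- corresponding vanishing combination of rows, so from any row of the support one
-- can move on, through the matching, to another one; this walk closes up to an
-- alternating cycle avoiding S, and S is not forcing.  Conversely the fibres over X
-- force the matching by fibres, because Y is independent.

module Submission where

open import Defs
open import Algebra.Apartness.Bundles using (HeytingField; HeytingCommutativeRing)
import Algebra.Apartness.Properties.HeytingCommutativeRing as HeytingProperties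
open import Algebra.Bundles using (CommutativeRing)
import Algebra.Properties.Ring as RingProperties
import Algebra.Properties.Semiring.Sum as SemiringSum
open import Data.Bool.Base using (T; if_then_else_)
open import Data.Bool.Properties using (T?)
open import Data.Fin.Base as Fin using (Fin; zero; suc; toℕ; punchIn; opposite)
open import Data.Fin.Patterns using (0F; 1F)
import Data.Fin.Properties as Fin
open import Data.List.Base using (List; lookup; filter; allFin; cartesianProduct)
open import Data.List.Membership.Propositional using (_∈_)
open import Data.List.Membership.Propositional.Properties
  using (∈-lookup; ∈-filter⁺; ∈-filter⁻; ∈-cartesianProduct⁺; ∈-allFin)
import Data.List.Relation.Unary.All as All
open import Data.List.Relation.Unary.AllPairs using (_∷_)
import Data.List.Relation.Unary.Any as Any
open import Data.List.Relation.Unary.Any.Properties using (lookup-index)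
open import Data.List.Relation.Unary.Unique.Propositional using (Unique)
open import Data.List.Relation.Unary.Unique.Propositional.Properties
  using (filter⁺; cartesianProduct⁺; allFin⁺)
open import Data.Nat.Base as ℕ using (ℕ; zero; suc; _≤_; _<_; s<s⁻¹)
open import Data.Nat.GeneralisedArithmetic using (fold; fold-+)
import Data.Nat.Properties as ℕ
open import Data.Product.Base using (∃-syntax; _×_; _,_; proj₁; proj₂)
open import Data.Sum.Base as Sum using (_⊎_; inj₁; inj₂)
open import Data.Sum.Function.Propositional using (_⊎-↔_)
open import Data.Sum.Properties using (inj₁-injective; inj₂-injective)
open import Data.Vec.Functional using (Vector; insertAt; removeAt)
open import Data.Vec.Functional.Properties using (insertAt-lookup; insertAt-punchIn)
open import Effect.Monad using (RawMonad)
open import Function.Base using (_∘_)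
open import Function.Bundles
  using (_↔_; _⇔_; mk⇔; module Equivalence; module Injection; module Inverse)
open import Function.Construct.Composition using (_↔-∘_)
open import Function.Construct.Symmetry using (↔-sym)
open import Function.Properties.Inverse using (↔⇒↣)
open import Level using (0ℓ)
open import Relation.Binary.Core using (Rel)
open import Relation.Binary.Definitions
  using (Decidable; DecidableEquality; Symmetric; tri<; tri≈; tri>)
import Relation.Binary.PropositionalEquality as ≡
open ≡ using (_≡_; _≢_)
open import Relation.Nullary.Decidable
  using (Dec; yes; no; does; ⌊_⌋; toWitness; fromWitness; isYes≗does; does-⇔;
         dec-true; dec-false; _×-dec_; ¬¬-excluded-middle)
open import Relation.Nullary.Negation using (¬_; contradiction; ¬¬-Monad; ¬¬-map)
open import Relation.Unary using (Satisfiable)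

-- Double negation commutes with finite conjunctions, so excluded middle may be assumed at all
-- points at once. Apartness is not decidable in general; this makes the support of a vector
-- decidable while a negative goal is being proved.
¬¬-∀-dec : ∀ {a p n} {A : Set a} → A ↔ Fin n → (P : A → Set p) → ¬ ¬ (∀ x → Dec (P x))
¬¬-∀-dec A↔Fin P = ¬¬-map
  (λ P? x → ≡.subst (Dec ∘ P) (Inverse.strictlyInverseʳ A↔Fin x) (P? (Inverse.to A↔Fin x)))
  (Fin.sequence (RawMonad.rawApplicative ¬¬-Monad)
    {P = Dec ∘ P ∘ Inverse.from A↔Fin} (λ _ → ¬¬-excluded-middle))

-- Linear algebra over a Heyting field

module LinearAlgebra {c ℓ₁ ℓ₂} (F : HeytingField c ℓ₁ ℓ₂) where
  open HeytingField F using (_#_; tight; #-cotrans; #⇒invertible; heytingCommutativeRing) public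
  open CommutativeRing (HeytingCommutativeRing.commutativeRing heytingCommutativeRing) public hiding (zero)
  open HeytingProperties heytingCommutativeRing public
    using (1#0; x-0≈x; x#0y#0→xy#0; #-congʳ; invertibleˡ⇒#)
  open RingProperties ring public
    using (-‿distribˡ-*; -‿distribʳ-*; -1*x≈-x; +-inverseˡ-unique)
  open SemiringSum semiring public
  open import Relation.Binary.Reasoning.Setoid setoid

  ¬0#0 : ¬ (0# # 0#)
  ¬0#0 = proj₂ (tight 0# 0#) refl

  -- Cotransitivity compares `y` with both `x + y` and `0#`; if `x + y` is apart from `y`, an
  -- inverse of `x + y - y` is an inverse of `x`.
  +#0⇒ : ∀ x {y} → x + y # 0# → x # 0# ⊎ y # 0#
  +#0⇒ x {y} x+y#0 with #-cotrans x+y#0 y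
  ... | inj₂ y#0   = inj₂ y#0
  ... | inj₁ x+y#y with #⇒invertible x+y#y
  ...   | z , z*[x+y-y]≈1 , _ = inj₁ (invertibleˡ⇒# (z , (begin
    z * (x - 0#)    ≈⟨ *-congˡ (x-0≈x x) ⟩
    z * x           ≈⟨ *-congˡ (+-identityʳ x) ⟨
    z * (x + 0#)    ≈⟨ *-congˡ (+-congˡ (-‿inverseʳ y)) ⟨
    z * (x + (y - y)) ≈⟨ *-congˡ (+-assoc x y (- y)) ⟨
    z * (x + y - y) ≈⟨ z*[x+y-y]≈1 ⟩
    1#              ∎)))

  -- If `z` inverts `x * y`, then `z * y` inverts `x`.
  *#0⇒ˡ : ∀ {x y} → x * y # 0# → x # 0#
  *#0⇒ˡ {x} {y} xy#0 with #⇒invertible xy#0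
  ... | z , z*xy≈1 , _ = invertibleˡ⇒# (z * y , (begin
    z * y * (x - 0#)   ≈⟨ *-congˡ (x-0≈x x) ⟩
    z * y * x          ≈⟨ *-assoc z y x ⟩
    z * (y * x)        ≈⟨ *-congˡ (*-comm y x) ⟩
    z * (x * y)        ≈⟨ *-congˡ (x-0≈x (x * y)) ⟨
    z * (x * y - 0#)   ≈⟨ z*xy≈1 ⟩
    1#                 ∎))

  *#0⇒ʳ : ∀ {x y} → x * y # 0# → y # 0#
  *#0⇒ʳ {x} {y} xy#0 = *#0⇒ˡ (#-congʳ (*-comm x y) xy#0)

  x+y≈0⇒y#0 : ∀ {x y} → x + y ≈ 0# → x # 0# → y # 0#
  x+y≈0⇒y#0 {x} {y} x+y≈0 x#0 = *#0⇒ʳ (#-congʳ x≈-1*y x#0)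
    where
    x≈-1*y : x ≈ - 1# * y
    x≈-1*y = trans (+-inverseˡ-unique x y x+y≈0) (sym (-1*x≈-x y))

  sum#0⇒ : ∀ {n} (t : Vector Carrier n) → sum t # 0# → ∃[ i ] t i # 0#
  sum#0⇒ {zero}  t 0#0 = contradiction 0#0 ¬0#0
  sum#0⇒ {suc n} t t#0 with +#0⇒ (t zero) t#0
  ... | inj₁ t₀#0 = zero , t₀#0
  ... | inj₂ r#0 with sum#0⇒ (t ∘ suc) r#0
  ...   | i , tᵢ#0 = suc i , tᵢ#0

  -- Once `t i` is nonzero, the remaining terms must sum to its negative, which is nonzero too. The
  -- summand `y` stands apart because it will be the contribution of an identity block.
  sum-remove#0⇒ : ∀ {n} (t : Vector Carrier n) i {y} →
                  sum t + y ≈ 0# → t i # 0# →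
                  (∃[ j ] j ≢ i × t j # 0#) ⊎ y # 0#
  sum-remove#0⇒ {suc n} t i {y} t+y≈0 tᵢ#0 =
    Sum.map₁ (λ r#0 → let j , tⱼ#0 = sum#0⇒ r r#0 in punchIn i j , Fin.punchInᵢ≢i i j , tⱼ#0)
      (+#0⇒ (sum r) (x+y≈0⇒y#0 split tᵢ#0))
    where
    r : Vector Carrier n
    r = removeAt t i

    split : t i + (sum r + y) ≈ 0#
    split = begin
      t i + (sum r + y) ≈⟨ +-assoc (t i) (sum r) y ⟨
      t i + sum r + y   ≈⟨ +-congʳ (sum-remove {i = i} t) ⟨
      sum t + y         ≈⟨ t+y≈0 ⟩
      0#                ∎

  sum-zero : ∀ {n} (t : Vector Carrier n) → (∀ i → t i ≈ 0#) → sum t ≈ 0#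
  sum-zero {n} t t≈0 = trans (sum-cong-≋ {n} t≈0) (sum-replicate-zero n)

  sum-single : ∀ {n} (t : Vector Carrier n) i → (∀ j → j ≢ i → t j ≈ 0#) → sum t ≈ t i
  sum-single {suc n} t i t≈0 = begin
    sum t                    ≈⟨ sum-remove {i = i} t ⟩
    t i + sum (removeAt t i) ≈⟨ +-congˡ (sum-zero _ λ j → t≈0 (punchIn i j) (Fin.punchInᵢ≢i i j)) ⟩
    t i + 0#                 ≈⟨ +-identityʳ (t i) ⟩
    t i                      ∎

  infix 7 _·_

  _·_ : ∀ {n} → Vector Carrier n → Vector Carrier n → Carrier
  p · q = sum λ i → p i * q i

  +*-· : ∀ {n} (p q : Vector Carrier n) x (v : Vector Carrier n) →
         (λ i → p i + x * q i) · v ≈ p · v + x * (q · v)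
  +*-· {n} p q x v = begin
    (λ i → p i + x * q i) · v                     ≈⟨ sum-cong-≋ (λ i → distribʳ (v i) (p i) (x * q i)) ⟩
    sum (λ i → p i * v i + x * q i * v i)         ≈⟨ ∑-distrib-+ {n} (λ i → p i * v i) (λ i → x * q i * v i) ⟩
    p · v + sum (λ i → x * q i * v i)             ≈⟨ +-congˡ (sum-cong-≋ λ i → *-assoc x (q i) (v i)) ⟩
    p · v + sum (λ i → x * (q i * v i))           ≈⟨ +-congˡ (*-distribˡ-sum {n} x (λ i → q i * v i)) ⟨
    p · v + x * (q · v)                           ∎

  ·-insertAt : ∀ {n} (p : Vector Carrier (suc n)) (v : Vector Carrier n) i x →
               p · insertAt v i x ≈ p i * x + removeAt p i · v
  ·-insertAt p v i x = begin
    p · insertAt v i x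
      ≈⟨ sum-remove {i = i} (λ j → p j * insertAt v i x j) ⟩
    p i * insertAt v i x i + removeAt p i · removeAt (insertAt v i x) i
      ≈⟨ +-cong (*-congˡ (reflexive (insertAt-lookup v i x)))
                (sum-cong-≋ λ j → *-congˡ (reflexive (insertAt-punchIn v i x j))) ⟩
    p i * x + removeAt p i · v ∎

  -- Deciding which coefficients vanish needs excluded middle, whence the
  -- double negation; the elimination itself is Gaussian, with pivot q i.
  kernel-nontrivial : ∀ {s n} → s < n → (Q : Fin s → Vector Carrier n) →
    ¬ ¬ (∃[ v ] (∃[ i ] v i # 0#) × (∀ k → Q k · v ≈ 0#))
  kernel-nontrivial {zero} {suc n} _ Q = contradiction ((λ _ → 1#) , (zero , 1#0) , λ ())
  kernel-nontrivial {suc s} {suc n} s<n Q ¬kernel =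
    ¬¬-excluded-middle λ where
      -- By tightness such a first row is zero and imposes no condition.
      (no  q≈0)        → kernel-nontrivial (ℕ.<-trans (ℕ.n<1+n s) s<n) (Q ∘ suc)
        λ (v , v≢0 , Qv≈0) → ¬kernel (v , v≢0 , λ where
          zero    → sum-zero (λ i → q i * v i) λ i →
            trans (*-congʳ (proj₁ (tight (q i) 0#) λ qᵢ#0 → q≈0 (i , qᵢ#0))) (zeroˡ (v i))
          (suc k) → Qv≈0 k)
      (yes (i , qᵢ#0)) → eliminate i (#⇒invertible qᵢ#0)
    where
    q : Vector Carrier (suc n)
    q = Q zero

    eliminate : ∀ i → (∃[ a ] (a * (q i - 0#) ≈ 1# × (q i - 0#) * a ≈ 1#)) → _
    eliminate i (a , a*[q-0]≈1 , _) = kernel-nontrivial (s<s⁻¹ s<n) Q′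
      λ (v , (j , vⱼ#0) , Q′v≈0) →
        -- With `v` given off the pivot, the value `- (a * T)` at coordinate `i` is the one that
        -- solves the pivot equation, `a` being the inverse of `q i`.
        let T = removeAt q i · v
            w = insertAt v i (- (a * T))
        in ¬kernel (w
          , (punchIn i j , #-congʳ (reflexive (≡.sym (insertAt-punchIn v i _ j))) vⱼ#0)
          , λ where
            zero → begin
              q · w                          ≈⟨ ·-insertAt q v i _ ⟩
              q i * - (a * T) + T            ≈⟨ +-congʳ (move (q i) T) ⟩
              - (q i * a) * T + T            ≈⟨ +-congʳ (*-congʳ (-‿cong (trans (*-comm _ _) a*q≈1))) ⟩
              - 1# * T + T                   ≈⟨ +-congʳ (-1*x≈-x T) ⟩
              - T + T                        ≈⟨ -‿inverseˡ T ⟩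
              0#                             ∎
            (suc k) → begin
              Q (suc k) · w                              ≈⟨ ·-insertAt (Q (suc k)) v i _ ⟩
              Q (suc k) i * - (a * T) + P k · v          ≈⟨ +-comm _ _ ⟩
              P k · v + Q (suc k) i * - (a * T)          ≈⟨ +-congˡ (move (Q (suc k) i) T) ⟩
              P k · v + - (Q (suc k) i * a) * T          ≈⟨ +*-· (P k) (removeAt q i) _ v ⟨
              Q′ k · v                                   ≈⟨ Q′v≈0 k ⟩
              0#                                         ∎)
      where
      P Q′ : Fin s → Vector Carrier n
      P k = removeAt (Q (suc k)) i
      -- Subtracting this multiple of the pivot row would clear column `i`, which is left out.
      Q′ k j = P k j + - (Q (suc k) i * a) * removeAt q i j

      a*q≈1 : a * q i ≈ 1#
      a*q≈1 = trans (*-congˡ (sym (x-0≈x (q i)))) a*[q-0]≈1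

      move : ∀ x T → x * - (a * T) ≈ - (x * a) * T
      move x T = begin
        x * - (a * T)   ≈⟨ -‿distribʳ-* x (a * T) ⟨
        - (x * (a * T)) ≈⟨ -‿cong (*-assoc x a T) ⟨
        - (x * a * T)   ≈⟨ -‿distribˡ-* (x * a) T ⟩
        - (x * a) * T   ∎

-- Periodic points of a self-map of a finite set

module CyclicShift {A : Set} (_≟_ : DecidableEquality A) (f : A → A) where

  fold-f : ∀ n x → fold (f x) f n ≡ f (fold x f n)
  fold-f zero    x = ≡.refl
  fold-f (suc n) x = ≡.cong f (fold-f n x)

  -- Among the first `n + 1` iterates two coincide, by pigeonhole. Writing the period as `suc q`
  -- records that it is positive.
  reaches-cycle : ∀ {n} → A ↔ Fin n → ∀ x →
                  ∃[ i ] ∃[ q ] (let c = fold x f i in fold c f (suc q) ≡ c)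
  reaches-cycle {n} A↔Fin x
    with i , j , i<j , eq ← Fin.pigeonhole (ℕ.n<1+n n) (λ k → Inverse.to A↔Fin (fold x f (toℕ k)))
    with q , i+q≡j ← ℕ.m≤n⇒∃[o]m+o≡n i<j = toℕ i , q , (begin
      fold (fold x f (toℕ i)) f (suc q)   ≡⟨ fold-+ x f (suc q) ⟨
      fold x f (suc q ℕ.+ toℕ i)          ≡⟨ ≡.cong (λ k → fold x f (suc k)) (ℕ.+-comm q (toℕ i)) ⟩
      fold x f (suc (toℕ i) ℕ.+ q)        ≡⟨ ≡.cong (fold x f) i+q≡j ⟩
      fold x f (toℕ j)                    ≡⟨ Injection.injective (↔⇒↣ A↔Fin) eq ⟨
      fold x f (toℕ i)                    ∎)
    where open ≡.≡-Reasoning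

  -- f permutes the points x with f^(q+1) x ≡ x; σ is f there and fixes all
  -- other points.
  module _ (q : ℕ) where
    -- One decidable equation replaces the choice of a single orbit: all cycles whose length divides
    -- `suc q` are rotated together.
    Periodic : A → Set
    Periodic x = fold x f (suc q) ≡ x

    periodic-fold : ∀ n {x} → Periodic x → Periodic (fold x f n)
    periodic-fold zero    px = px
    periodic-fold (suc n) px = ≡.trans (fold-f (suc q) _) (≡.cong f (periodic-fold n px))

    σ σ⁻¹ : A → A
    σ x with fold x f (suc q) ≟ x
    ... | yes _ = f x
    ... | no _  = x
    σ⁻¹ x with fold x f (suc q) ≟ x
    ... | yes _ = fold x f q
    ... | no _  = x

    σ-periodic : ∀ {x} → Periodic x → σ x ≡ f x
    σ-periodic {x} px with fold x f (suc q) ≟ x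
    ... | yes _  = ≡.refl
    ... | no ¬px = contradiction px ¬px

    σσ⁻¹ : ∀ x → σ (σ⁻¹ x) ≡ x
    σσ⁻¹ x with fold x f (suc q) ≟ x
    -- The point `fold x f q` is again periodic, so `σ` acts on it as `f` and closes the cycle.
    ... | yes px = ≡.trans (σ-periodic (periodic-fold q px)) px
    ... | no ¬px with fold x f (suc q) ≟ x
    ...   | yes px = contradiction px ¬px
    ...   | no _   = ≡.refl

    σ⁻¹σ : ∀ x → σ⁻¹ (σ x) ≡ x
    σ⁻¹σ x with fold x f (suc q) ≟ x
    ... | yes px with fold (f x) f (suc q) ≟ f x
    ...   | yes _  = ≡.trans (fold-f q x) px
    ...   | no ¬p  = contradiction (periodic-fold 1 px) ¬p
    σ⁻¹σ x | no ¬px with fold x f (suc q) ≟ x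
    ...   | yes px = contradiction px ¬px
    ...   | no _   = ≡.refl

    σ-moves : ∀ x → σ x ≡ f x ⊎ σ x ≡ x
    σ-moves x with fold x f (suc q) ≟ x
    ... | yes _ = inj₁ ≡.refl
    ... | no _  = inj₂ ≡.refl

-- Edge sets, perfect matchings and the enumeration of edges

lookup-injective : ∀ {A : Set} {xs : List A} → Unique xs →
                   ∀ {i j} → lookup xs i ≡ lookup xs j → i ≡ j
lookup-injective (x∉xs ∷ _) {zero}  {zero}  eq = ≡.refl
lookup-injective (x∉xs ∷ _) {zero}  {suc j} eq = contradiction eq (All.lookup x∉xs (∈-lookup j))
lookup-injective (x∉xs ∷ _) {suc i} {zero}  eq = contradiction (≡.sym eq) (All.lookup x∉xs (∈-lookup i))
lookup-injective (_ ∷ xs!)  {suc i} {suc j} eq = ≡.cong suc (lookup-injective xs! eq)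

module _ {H : Graph} where
  open Graph H
  open EdgeSet

  fromRelation : ∀ {R : Rel V 0ℓ} → Decidable R → Symmetric R → (∀ {u v} → R u v → u ~ v) → EdgeSet H
  fromRelation R? R-sym R⇒~ = record
    { member     = λ u v → ⌊ R? u v ⌋
    ; member-sym = λ u v → ≡.trans (isYes≗does (R? u v))
        (≡.trans (does-⇔ (mk⇔ R-sym R-sym) (R? u v) (R? v u)) (≡.sym (isYes≗does (R? v u))))
    ; member⇒~   = R⇒~ ∘ toWitness
    }

  ∋-sym : ∀ (E : EdgeSet H) {u v} → E ∋ u — v → E ∋ v — u
  ∋-sym E {u} {v} = ≡.subst T (member-sym E u v)

  -- A perfect matching amounts to an involution sending each vertex to a neighbour; `Mate` goes the
  -- other way.
  fromInvolution : (μ : V → V) → (∀ v → μ (μ v) ≡ v) → (∀ v → v ~ μ v) → EdgeSet H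
  fromInvolution μ μμ v~μv = fromRelation (λ u v → μ u ≟ v)
    (λ μu≡v → ≡.trans (≡.cong μ (≡.sym μu≡v)) (μμ _)) (λ { ≡.refl → v~μv _ })

  fromInvolution-isPerfectMatching : ∀ μ μμ v~μv → IsPerfectMatching {H} (fromInvolution μ μμ v~μv)
  fromInvolution-isPerfectMatching μ μμ v~μv u = μ u , fromWitness ≡.refl , toWitness

  module Mate (M : EdgeSet H) (pm : IsPerfectMatching M) where
    mate : V → V
    mate v = proj₁ (pm v)

    mate-∋ : ∀ v → M ∋ v — mate v
    mate-∋ v = proj₁ (proj₂ (pm v))

    mate-unique : ∀ {v w} → M ∋ v — w → mate v ≡ w
    mate-unique {v} = proj₂ (proj₂ (pm v))

    mate-~ : ∀ v → v ~ mate v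
    mate-~ v = member⇒~ M (mate-∋ v)

    mate-involutive : ∀ v → mate (mate v) ≡ v
    mate-involutive v = mate-unique (∋-sym M (mate-∋ v))

  vertex-index : ∀ v → vertex (Inverse.to index v) ≡ v
  vertex-index = Inverse.strictlyInverseʳ index

  vertex-injective : ∀ {i j} → vertex i ≡ vertex j → i ≡ j
  vertex-injective = Injection.injective (↔⇒↣ (↔-sym index))

  module _ (E : EdgeSet H) where
    -- This repeats the filter inside `size`, so that `Fin (size E)` indexes `orientedEdges` by
    -- definition.
    oriented? : ∀ (e : Fin order × Fin order) →
                Dec (proj₁ e Fin.< proj₂ e × E ∋ vertex (proj₁ e) — vertex (proj₂ e))
    oriented? (i , j) = (i Fin.<? j) ×-dec T? (member E (vertex i) (vertex j))

    vertexPairs orientedEdges : List (Fin order × Fin order)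
    vertexPairs   = cartesianProduct (allFin order) (allFin order)
    orientedEdges = filter oriented? vertexPairs

    endpoint₁ endpoint₂ : Fin (size E) → V
    endpoint₁ k = vertex (proj₁ (lookup orientedEdges k))
    endpoint₂ k = vertex (proj₂ (lookup orientedEdges k))

    endpoints-oriented : ∀ k → proj₁ (lookup orientedEdges k) Fin.< proj₂ (lookup orientedEdges k) ×
                               E ∋ endpoint₁ k — endpoint₂ k
    endpoints-oriented k = proj₂ (∈-filter⁻ oriented? {xs = vertexPairs} (∈-lookup {xs = orientedEdges} k))

    endpoints-∋ : ∀ k → E ∋ endpoint₁ k — endpoint₂ k
    endpoints-∋ = proj₂ ∘ endpoints-oriented

    -- The enumerated pairs are distinct and increasing, so even an edge read backwards cannot occur
    -- twice.
    endpoints-injective : ∀ {k l} →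
      (endpoint₁ k ≡ endpoint₁ l × endpoint₂ k ≡ endpoint₂ l) ⊎
      (endpoint₁ k ≡ endpoint₂ l × endpoint₂ k ≡ endpoint₁ l) → k ≡ l
    endpoints-injective (inj₁ (eq₁ , eq₂)) =
      lookup-injective (filter⁺ oriented? (cartesianProduct⁺ (allFin⁺ order) (allFin⁺ order)))
        (≡.cong₂ _,_ (vertex-injective eq₁) (vertex-injective eq₂))
    endpoints-injective {k} {l} (inj₂ (eq₁ , eq₂)) = contradiction (proj₁ (endpoints-oriented k))
      (ℕ.<-asym (≡.subst₂ Fin._<_ (≡.sym (vertex-injective eq₂)) (≡.sym (vertex-injective eq₁))
        (proj₁ (endpoints-oriented l))))

    orient : ∀ {u v} → Inverse.to index u Fin.< Inverse.to index v → E ∋ u — v →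
             ∃[ k ] (endpoint₁ k ≡ u × endpoint₂ k ≡ v)
    orient {u} {v} u<v u—v = Any.index e∈ , ends (lookup-index e∈)
        where
        e∈ : (Inverse.to index u , Inverse.to index v) ∈ orientedEdges
        e∈ = ∈-filter⁺ oriented? (∈-cartesianProduct⁺ (∈-allFin _) (∈-allFin _))
               (u<v , ≡.subst₂ (E ∋_—_) (≡.sym (vertex-index u)) (≡.sym (vertex-index v)) u—v)
        ends : ∀ {e} → (Inverse.to index u , Inverse.to index v) ≡ e →
               vertex (proj₁ e) ≡ u × vertex (proj₂ e) ≡ v
        ends ≡.refl = vertex-index u , vertex-index v

    endpoints-surjective : ∀ {u v} → E ∋ u — v → ∃[ k ]
      ((endpoint₁ k ≡ u × endpoint₂ k ≡ v) ⊎ (endpoint₁ k ≡ v × endpoint₂ k ≡ u))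
    endpoints-surjective {u} {v} u—v with Fin.<-cmp (Inverse.to index u) (Inverse.to index v)
    ... | tri< i<j _ _ = let k , eq₁ , eq₂ = orient i<j u—v in k , inj₁ (eq₁ , eq₂)
    ... | tri> _ _ j<i = let k , eq₁ , eq₂ = orient j<i (∋-sym E u—v) in k , inj₂ (eq₁ , eq₂)
    ... | tri≈ _ i≡j _ = contradiction (member⇒~ E u—v)
                           (≡.subst (λ w → ¬ (u ~ w)) (Injection.injective (↔⇒↣ index) i≡j) ~-irr)

  -- Iterating step closes up to an M-alternating cycle avoiding S; conjugating M
  -- by the cyclic shift σ of that cycle yields a second perfect matching ⊇ S.
  module AlternatingCycle
    {M S : EdgeSet H} (pm : IsPerfectMatching M) (forcing : IsForcingSet {H} M S)
    {p} {P : V → Set p} (P? : ∀ v → Dec (P v))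
    (independent : ∀ {v w} → P v → P w → ¬ (v ~ w))
    (avoids : ∀ {v w} → P v → ¬ (S ∋ v — w))
    (step : ∀ {v} → P v → ∃[ v′ ] v′ ≢ v × P v′ × v′ ~ Mate.mate M pm v)
    where
    open Mate M pm

    -- The default value makes `next`, and with it `σ`, the identity outside the independent set
    -- `P`.
    next : V → V
    next v with P? v
    ... | yes Pv = proj₁ (step Pv)
    ... | no _   = v

    next-outside : ∀ {v} → ¬ P v → next v ≡ v
    next-outside {v} ¬Pv with P? v
    ... | yes Pv = contradiction Pv ¬Pv
    ... | no _   = ≡.refl

    next-inside : ∀ {v} → P v → next v ≢ v × P (next v) × next v ~ mate v
    next-inside {v} Pv with P? v
    ... | yes Pv = proj₂ (step Pv)
    ... | no ¬Pv = contradiction Pv ¬Pv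

    fold-next : ∀ n {v} → P v → P (fold v next n)
    fold-next zero    Pv = Pv
    fold-next (suc n) Pv = proj₁ (proj₂ (next-inside (fold-next n Pv)))

    open CyclicShift _≟_ next

    module _ (q : ℕ) where
      σ-outside : ∀ {v} → ¬ P v → σ q v ≡ v
      σ-outside {v} ¬Pv with σ-moves q v
      ... | inj₁ eq = ≡.trans eq (next-outside ¬Pv)
      ... | inj₂ eq = eq

      σ-~ : ∀ {v} → P v → σ q v ~ mate v
      σ-~ {v} Pv with σ-moves q v
      ... | inj₁ eq = ≡.subst (_~ mate v) (≡.sym eq) (proj₂ (proj₂ (next-inside Pv)))
      ... | inj₂ eq = ≡.subst (_~ mate v) (≡.sym eq) (mate-~ v)

      -- A matching edge has at most one end in `P`. Only that end moves, and it moves to a vertex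
      -- adjacent to the fixed end. Hence `rotated` below still pairs neighbours.
      σ-preserves-matching : ∀ v → σ q v ~ σ q (mate v)
      σ-preserves-matching v with P? v | P? (mate v)
      ... | yes Pv | yes Pw = contradiction (mate-~ v) (independent Pv Pw)
      ... | yes Pv | no ¬Pw = ≡.subst (σ q v ~_) (≡.sym (σ-outside ¬Pw)) (σ-~ Pv)
      ... | no ¬Pv | no ¬Pw = ≡.subst₂ _~_ (≡.sym (σ-outside ¬Pv)) (≡.sym (σ-outside ¬Pw)) (mate-~ v)
      ... | no ¬Pv | yes Pw = ≡.subst (_~ σ q (mate v)) (≡.sym (σ-outside ¬Pv))
              (~-sym (≡.subst (σ q (mate v) ~_) (mate-involutive v) (σ-~ Pw)))

      rotated : V → V
      rotated v = σ q (mate (σ⁻¹ q v))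

      rotated-σ : ∀ v → rotated (σ q v) ≡ σ q (mate v)
      rotated-σ v = ≡.cong (σ q ∘ mate) (σ⁻¹σ q v)

      rotated-involutive : ∀ v → rotated (rotated v) ≡ v
      rotated-involutive v = begin
        rotated (rotated v)             ≡⟨ rotated-σ (mate (σ⁻¹ q v)) ⟩
        σ q (mate (mate (σ⁻¹ q v)))     ≡⟨ ≡.cong (σ q) (mate-involutive (σ⁻¹ q v)) ⟩
        σ q (σ⁻¹ q v)                   ≡⟨ σσ⁻¹ q v ⟩
        v                               ∎
        where open ≡.≡-Reasoning

      rotated-~ : ∀ v → v ~ rotated v
      rotated-~ v = ≡.subst (_~ rotated v) (σσ⁻¹ q v) (σ-preserves-matching (σ⁻¹ q v))

      M′ : EdgeSet H
      M′ = fromInvolution rotated rotated-involutive rotated-~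

      -- Both ends of an edge of `S` lie outside `P`, where `σ` does nothing.
      S⊆M′ : S ⊆ M′
      S⊆M′ {u} {v} u—v = fromWitness (begin
        rotated u          ≡⟨ ≡.cong rotated (σ-outside (λ Pu → avoids Pu u—v)) ⟨
        rotated (σ q u)    ≡⟨ rotated-σ u ⟩
        σ q (mate u)       ≡⟨ ≡.cong (σ q) (mate-unique (proj₁ forcing u—v)) ⟩
        σ q v              ≡⟨ σ-outside (λ Pv → avoids Pv (∋-sym S u—v)) ⟩
        v                  ∎)
        where open ≡.≡-Reasoning

      -- On a periodic `c`, the new matching joins `mate c` to `next c`. Forcing identifies it with
      -- `M`, which joins `mate c` to `c`, although `next c` differs from `c`.
      not-periodic : ∀ {c} → P c → ¬ Periodic q c
      not-periodic {c} Pc per = proj₁ (next-inside Pc) (begin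
        next c          ≡⟨ σ-periodic q per ⟨
        σ q c           ≡⟨ mate-unique (∋-sym M (M′⊆M (fromWitness rotated-σc))) ⟨
        mate (mate c)   ≡⟨ mate-involutive c ⟩
        c               ∎)
        where
        open ≡.≡-Reasoning
        M′⊆M : M′ ⊆ M
        M′⊆M = proj₁ (proj₂ forcing M′ (fromInvolution-isPerfectMatching rotated rotated-involutive rotated-~) S⊆M′)

        rotated-σc : rotated (σ q c) ≡ mate c
        rotated-σc = ≡.trans (rotated-σ c) (σ-outside (λ Pw → independent Pc Pw (mate-~ c)))

    -- The iterates of `next` stay in `P`, yet by finiteness they reach a periodic point.
    P-empty : ∀ v → ¬ P v
    P-empty v Pv = let i , q , per = reaches-cycle index v in not-periodic q (fold-next i Pv) per

-- The prism: fibre matching and upper bound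

opposite-≢ : ∀ (h : Fin 2) → h ≢ opposite h
opposite-≢ 0F ()
opposite-≢ 1F ()

≢⇒opposite : ∀ {h h′ : Fin 2} → h ≢ h′ → opposite h ≡ h′
≢⇒opposite {0F} {0F} h≢h′ = contradiction ≡.refl h≢h′
≢⇒opposite {0F} {1F} h≢h′ = ≡.refl
≢⇒opposite {1F} {0F} h≢h′ = ≡.refl
≢⇒opposite {1F} {1F} h≢h′ = contradiction ≡.refl h≢h′

module Prism {G : Graph} {m n : ℕ} (place : (Fin m ⊎ Fin n) ↔ Graph.V G)
  (X-independent : ∀ i i′ → ¬ Graph._~_ G (Inverse.to place (inj₁ i)) (Inverse.to place (inj₁ i′)))
  (Y-independent : ∀ j j′ → ¬ Graph._~_ G (Inverse.to place (inj₂ j)) (Inverse.to place (inj₂ j′)))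
  where
  open Graph G using (V; _~_; ~-sym; ~-irr)
  open Inverse place using () renaming (to to at; from to part)
  module H = Graph (G □ K 2)

  at-part : ∀ g → at (part g) ≡ g
  at-part = Inverse.strictlyInverseˡ place

  part-at : ∀ z → part (at z) ≡ z
  part-at = Inverse.strictlyInverseʳ place

  at-injective : ∀ z z′ → at z ≡ at z′ → z ≡ z′
  at-injective _ _ = Injection.injective (↔⇒↣ place)

  part-injective : ∀ g g′ → part g ≡ part g′ → g ≡ g′
  part-injective _ _ = Injection.injective (↔⇒↣ (↔-sym place))

  fibreMate : H.V → H.V
  fibreMate (g , h) = g , opposite h

  fibreMate-involutive : ∀ v → fibreMate (fibreMate v) ≡ v
  fibreMate-involutive (g , h) = ≡.cong (g ,_) (Fin.opposite-involutive h)

  fibreMate-~ : ∀ v → v H.~ fibreMate v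
  fibreMate-~ (g , h) = inj₁ (≡.refl , opposite-≢ h)

  fibres : EdgeSet (G □ K 2)
  fibres = fromInvolution fibreMate fibreMate-involutive fibreMate-~

  fibres-isPerfectMatching : IsPerfectMatching fibres
  fibres-isPerfectMatching = fromInvolution-isPerfectMatching {G □ K 2} fibreMate fibreMate-involutive fibreMate-~

  X-part? : ∀ g → Dec (∃[ i ] part g ≡ inj₁ i)
  X-part? g with part g
  ... | inj₁ i = yes (i , ≡.refl)
  ... | inj₂ j = no λ ()

  X-fibre : H.V → H.V → Set
  X-fibre u v = fibreMate u ≡ v × (∃[ i ] part (proj₁ u) ≡ inj₁ i)

  X-fibres : EdgeSet (G □ K 2)
  X-fibres = fromRelation {R = X-fibre} (λ u v → (fibreMate u H.≟ v) ×-dec X-part? (proj₁ u))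
    (λ { {u} (≡.refl , x) → fibreMate-involutive u , x })
    (λ { {u} (≡.refl , _) → fibreMate-~ u })

  open EdgeSet

  X-fibres-∋ : ∀ u v → X-fibres ∋ u — v → X-fibre u v
  X-fibres-∋ u v = toWitness

  -- Over `X` the mates are prescribed. A vertex over `Y` matched inside its layer would, by
  -- independence of `Y`, be matched to a vertex over `X`, which is already taken by its own fibre.
  X-fibres-forcing : IsForcingSet fibres X-fibres
  X-fibres-forcing = (λ {u} {v} e → fromWitness (proj₁ (X-fibres-∋ u v e))) , forced
    where
    forced : ∀ M → IsPerfectMatching M → X-fibres ⊆ M → M ≐ fibres
    forced M pm X⊆M = (λ e → fromWitness (≡.trans (≡.sym (mate≡ _)) (mate-unique e)))
                    , (λ {u} e → ≡.subst (M ∋ u —_) (≡.trans (mate≡ u) (toWitness e)) (mate-∋ u))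
      where
      open Mate M pm

      mate-X : ∀ {g h i} → part g ≡ inj₁ i → mate (g , h) ≡ fibreMate (g , h)
      mate-X x = mate-unique (X⊆M (fromWitness (≡.refl , (_ , x))))

      mate≡ : ∀ v → mate v ≡ fibreMate v
      mate≡ (g , h) with part g in g∈
      ... | inj₁ i = mate-X g∈
      ... | inj₂ j with mate (g , h) in eq | mate-~ (g , h)
      ...   | g′ , h′ | inj₁ (≡.refl , h≢h′) = ≡.cong (g ,_) (≡.sym (≢⇒opposite h≢h′))
      ...   | g′ , h′ | inj₂ (≡.refl , g~g′) with part g′ in g′∈
      ...     | inj₂ j′ = contradiction
                  (≡.subst₂ _~_ (≡.trans (≡.sym (at-part g)) (≡.cong at g∈))
                                (≡.trans (≡.sym (at-part g′)) (≡.cong at g′∈)) g~g′)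
                  (Y-independent j j′)
      ...     | inj₁ i′ = contradiction (≡.subst (g ~_) (≡.sym g≡g′) g~g′) ~-irr
                where
                g≡g′ : g ≡ g′
                g≡g′ = ≡.cong proj₁ (≡.trans (≡.sym (mate-involutive (g , h)))
                         (≡.trans (≡.cong mate eq) (mate-X g′∈)))

  -- Two vertices over the same element of `X` are equal or joined by the fibre, so edges inject
  -- into `Fin m`. The reverse inequality comes from the lower bound applied to this forcing set.
  X-fibres-size : size X-fibres ≤ m
  X-fibres-size = Fin.injective⇒≤ {f = proj₁ ∘ X-end} λ {k} {l} → injective k l
    where
    X-end : ∀ k → ∃[ i ] part (proj₁ (endpoint₁ X-fibres k)) ≡ inj₁ i
    X-end k = proj₂ (X-fibres-∋ (endpoint₁ X-fibres k) (endpoint₂ X-fibres k) (endpoints-∋ X-fibres k))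

    fibreMate-endpoint₁ : ∀ k → fibreMate (endpoint₁ X-fibres k) ≡ endpoint₂ X-fibres k
    fibreMate-endpoint₁ k = proj₁ (X-fibres-∋ (endpoint₁ X-fibres k) (endpoint₂ X-fibres k) (endpoints-∋ X-fibres k))

    same-fibre : ∀ u v → proj₁ u ≡ proj₁ v → u ≡ v ⊎ fibreMate u ≡ v
    same-fibre (g , h) (g , h′) ≡.refl with h Fin.≟ h′
    ... | yes ≡.refl = inj₁ ≡.refl
    ... | no h≢h′    = inj₂ (≡.cong (g ,_) (≢⇒opposite h≢h′))

    injective : ∀ k l → proj₁ (X-end k) ≡ proj₁ (X-end l) → k ≡ l
    injective k l eq = endpoints-injective X-fibres (Sum.map
      (λ u≡v → u≡v , ≡.trans (≡.sym (fibreMate-endpoint₁ k))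
                       (≡.trans (≡.cong fibreMate u≡v) (fibreMate-endpoint₁ l)))
      (λ u′≡v → ≡.trans (≡.sym (fibreMate-involutive (endpoint₁ X-fibres k)))
                  (≡.trans (≡.cong fibreMate u′≡v) (fibreMate-endpoint₁ l))
              , ≡.trans (≡.sym (fibreMate-endpoint₁ k)) u′≡v)
      (same-fibre (endpoint₁ X-fibres k) (endpoint₁ X-fibres l)
        (part-injective _ _
          (≡.trans (proj₂ (X-end k)) (≡.trans (≡.cong inj₁ eq) (≡.sym (proj₂ (X-end l))))))))

  -- The two colour classes of the prism, {α z} = X × {0} ∪ Y × {1} and
  -- {β z} = X × {1} ∪ Y × {0}, both indexed by V(G).
  α β : Fin m ⊎ Fin n → H.V
  α z@(inj₁ _) = at z , 0F
  α z@(inj₂ _) = at z , 1F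
  β = fibreMate ∘ α

  part-α : ∀ z → part (proj₁ (α z)) ≡ z
  part-α z@(inj₁ _) = part-at z
  part-α z@(inj₂ _) = part-at z

  colour : ∀ v → let z = part (proj₁ v) in v ≡ α z ⊎ v ≡ β z
  colour (g , h) with part g | at-part g
  colour (_ , 0F) | inj₁ i | ≡.refl = inj₁ ≡.refl
  colour (_ , 1F) | inj₁ i | ≡.refl = inj₂ ≡.refl
  colour (_ , 0F) | inj₂ j | ≡.refl = inj₂ ≡.refl
  colour (_ , 1F) | inj₂ j | ≡.refl = inj₁ ≡.refl

  α-independent : ∀ z z′ → ¬ (α z H.~ α z′)
  α-independent (inj₁ i) (inj₁ i′) (inj₁ (_ , 0≢0)) = 0≢0 ≡.refl
  α-independent (inj₁ i) (inj₁ i′) (inj₂ (_ , x~x)) = X-independent i i′ x~x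
  α-independent (inj₂ j) (inj₂ j′) (inj₁ (_ , 1≢1)) = 1≢1 ≡.refl
  α-independent (inj₂ j) (inj₂ j′) (inj₂ (_ , y~y)) = Y-independent j j′ y~y
  α-independent (inj₁ i) (inj₂ j) (inj₁ (x≡y , _)) with () ← at-injective (inj₁ i) (inj₂ j) x≡y
  α-independent (inj₂ j) (inj₁ i) (inj₁ (y≡x , _)) with () ← at-injective (inj₂ j) (inj₁ i) y≡x

  -- The lower bound from kernel vectors

  module LowerBound {c ℓ₁ ℓ₂} (F : HeytingField c ℓ₁ ℓ₂) where
    open LinearAlgebra F

    module Weighted
      (B C : Fin m → Vector Carrier n)
      (B#0⇔~ : ∀ i j → (B i j # 0#) ⇔ (at (inj₁ i) ~ at (inj₂ j)))
      (C#0⇔~ : ∀ i j → (C i j # 0#) ⇔ (at (inj₁ i) ~ at (inj₂ j)))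
      (BCᵀ-diagonal : ∀ i → B i · C i ≈ 1#)
      (BCᵀ-off : ∀ {i i′} → i ≢ i′ → B i · C i′ ≈ 0#)
      where
      open import Relation.Binary.Reasoning.Setoid setoid

      B#0⇒~ : ∀ i j → B i j # 0# → at (inj₁ i) ~ at (inj₂ j)
      B#0⇒~ i j = Equivalence.to (B#0⇔~ i j)

      C#0⇒~ : ∀ i j → C i j # 0# → at (inj₂ j) ~ at (inj₁ i)
      C#0⇒~ i j = ~-sym ∘ Equivalence.to (C#0⇔~ i j)

      -- u z = weight z · p runs through the left kernel of the weighted
      -- bi-adjacency matrix [ I , B ; Cᵀ , I ] of the prism as p runs through F^m.
      weight : Fin m ⊎ Fin n → Vector Carrier m
      weight (inj₁ i) i′ = B i′ · C i
      weight (inj₂ j) i′ = - B i′ j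

      module _ (p : Vector Carrier m) where
        u : Fin m ⊎ Fin n → Carrier
        u z = weight z · p

        -- The relation B Cᵀ = I enters the kernel computation here: it collapses the sum to one
        -- term. In particular a nonzero `p` yields a nonzero `u`.
        u-X : ∀ i → u (inj₁ i) ≈ p i
        u-X i = begin
          sum (λ i′ → (B i′ · C i) * p i′)
            ≈⟨ sum-single _ i (λ i′ i′≢i → trans (*-congʳ (BCᵀ-off i′≢i)) (zeroˡ _)) ⟩
          (B i · C i) * p i
            ≈⟨ *-congʳ (BCᵀ-diagonal i) ⟩
          1# * p i
            ≈⟨ *-identityˡ (p i) ⟩
          p i ∎

        -- In the column of `β (inj₂ j)` the block `B` contributes (pB)ⱼ, and the identity block
        -- contributes its negative.
        column-Y : ∀ j → sum (λ i → u (inj₁ i) * B i j) + u (inj₂ j) ≈ 0#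
        column-Y j = begin
          sum (λ i → u (inj₁ i) * B i j) + u (inj₂ j)
            ≈⟨ ∑-distrib-+ (λ i → u (inj₁ i) * B i j) (λ i → - B i j * p i) ⟨
          sum (λ i → u (inj₁ i) * B i j + - B i j * p i)
            ≈⟨ sum-zero _ (λ i → trans (+-cong (trans (*-congʳ (u-X i)) (*-comm (p i) (B i j)))
                 (sym (-‿distribˡ-* (B i j) (p i)))) (-‿inverseʳ _)) ⟩
          0# ∎

        -- After exchanging the sums, the block Cᵀ contributes -(p B Cᵀ)ᵢ. It cancels the identity
        -- block because the weights over `X` are written as entries of B Cᵀ.
        column-X : ∀ i → sum (λ j → u (inj₂ j) * C i j) + u (inj₁ i) ≈ 0#
        column-X i = begin
          sum (λ j → sum (λ i′ → - B i′ j * p i′) * C i j) + sum (λ i′ → (B i′ · C i) * p i′)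
            ≈⟨ +-congʳ (sum-cong-≋ {n} λ j → *-distribʳ-sum (C i j) (λ i′ → - B i′ j * p i′)) ⟩
          sum (λ j → sum (λ i′ → - B i′ j * p i′ * C i j)) + sum (λ i′ → (B i′ · C i) * p i′)
            ≈⟨ +-congʳ (∑-comm (λ j i′ → - B i′ j * p i′ * C i j)) ⟩
          sum (λ i′ → sum (λ j → - B i′ j * p i′ * C i j)) + sum (λ i′ → (B i′ · C i) * p i′)
            ≈⟨ ∑-distrib-+ (λ i′ → sum (λ j → - B i′ j * p i′ * C i j)) (λ i′ → (B i′ · C i) * p i′) ⟨
          sum (λ i′ → sum (λ j → - B i′ j * p i′ * C i j) + (B i′ · C i) * p i′)
            ≈⟨ sum-zero _ (λ i′ → trans (+-congʳ (row i′)) (-‿inverseˡ _)) ⟩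
          0# ∎
          where
          rearrange : ∀ b q d → - b * q * d ≈ - q * (b * d)
          rearrange b q d = begin
            - b * q * d   ≈⟨ *-congʳ (-‿distribˡ-* b q) ⟨
            - (b * q) * d ≈⟨ *-congʳ (-‿cong (*-comm b q)) ⟩
            - (q * b) * d ≈⟨ *-congʳ (-‿distribˡ-* q b) ⟩
            - q * b * d   ≈⟨ *-assoc (- q) b d ⟩
            - q * (b * d) ∎

          row : ∀ i′ → sum (λ j → - B i′ j * p i′ * C i j) ≈ - ((B i′ · C i) * p i′)
          row i′ = begin
            sum (λ j → - B i′ j * p i′ * C i j)     ≈⟨ sum-cong-≋ {n} (λ j → rearrange (B i′ j) (p i′) (C i j)) ⟩
            sum (λ j → - p i′ * (B i′ j * C i j))   ≈⟨ *-distribˡ-sum (- p i′) (λ j → B i′ j * C i j) ⟨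
            - p i′ * (B i′ · C i)                   ≈⟨ -‿distribˡ-* (p i′) (B i′ · C i) ⟨
            - (p i′ * (B i′ · C i))                 ≈⟨ -‿cong (*-comm (p i′) (B i′ · C i)) ⟩
            - ((B i′ · C i) * p i′)                 ∎

        -- In each column of the matrix, a kernel vector has no isolated nonzero term.
        another : ∀ z z′ → u z # 0# → α z H.~ β z′ → ∃[ z″ ] z″ ≢ z × u z″ # 0# × α z″ H.~ β z′
        -- Along a fibre edge the given term is the identity entry, so the other block must supply a
        -- nonzero term.
        another (inj₁ i) (inj₁ i′) u#0 (inj₁ (x≡x′ , _))
          with ≡.refl ← inj₁-injective (at-injective (inj₁ i) (inj₁ i′) x≡x′)
          with j , t#0 ← sum#0⇒ _ (x+y≈0⇒y#0 (trans (+-comm _ _) (column-X i)) u#0)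
          = inj₂ j , (λ ()) , *#0⇒ˡ t#0 , inj₂ (≡.refl , C#0⇒~ _ _ (*#0⇒ʳ t#0))
        another (inj₂ j) (inj₁ i) u#0 (inj₂ (_ , y~x))
          with sum-remove#0⇒ (λ j → u (inj₂ j) * C i j) j (column-X i)
                 (x#0y#0→xy#0 u#0 (Equivalence.from (C#0⇔~ i j) (~-sym y~x)))
        ... | inj₁ (j′ , j′≢j , t#0) = inj₂ j′ , j′≢j ∘ inj₂-injective , *#0⇒ˡ t#0
                                     , inj₂ (≡.refl , C#0⇒~ _ _ (*#0⇒ʳ t#0))
        -- Here the second nonzero term is the identity entry, reached along a fibre edge.
        ... | inj₂ uᵢ#0              = inj₁ i , (λ ()) , uᵢ#0 , inj₁ (≡.refl , λ ())
        another (inj₁ i) (inj₂ j) u#0 (inj₂ (_ , x~y))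
          with sum-remove#0⇒ (λ i → u (inj₁ i) * B i j) i (column-Y j)
                 (x#0y#0→xy#0 u#0 (Equivalence.from (B#0⇔~ i j) x~y))
        ... | inj₁ (i′ , i′≢i , t#0) = inj₁ i′ , i′≢i ∘ inj₁-injective , *#0⇒ˡ t#0
                                     , inj₂ (≡.refl , B#0⇒~ _ _ (*#0⇒ʳ t#0))
        ... | inj₂ uⱼ#0              = inj₂ j , (λ ()) , uⱼ#0 , inj₁ (≡.refl , λ ())
        another (inj₂ j) (inj₂ j′) u#0 (inj₁ (y≡y′ , _))
          with ≡.refl ← inj₂-injective (at-injective (inj₂ j) (inj₂ j′) y≡y′)
          with i , t#0 ← sum#0⇒ _ (x+y≈0⇒y#0 (trans (+-comm _ _) (column-Y j)) u#0)
          = inj₁ i , (λ ()) , *#0⇒ˡ t#0 , inj₂ (≡.refl , B#0⇒~ _ _ (*#0⇒ʳ t#0))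
        -- In the last two cases both ends lie in one layer, so no fibre edge joins them.
        another (inj₁ i) (inj₂ j) u#0 (inj₁ (_ , 0≢0)) = contradiction ≡.refl 0≢0
        another (inj₂ j) (inj₁ i) u#0 (inj₁ (_ , 1≢1)) = contradiction ≡.refl 1≢1

      module _ {M S : EdgeSet (G □ K 2)} (pm : IsPerfectMatching M) (forcing : IsForcingSet M S) where
        open Mate M pm
        open EdgeSet

        -- For an edge this is the matrix row it meets, that is, the index of its end of colour `α`.
        -- The comparison with `α (part (proj₁ v))` tests the colour of `v`.
        αEnd : H.V → H.V → Fin m ⊎ Fin n
        αEnd v w = part (proj₁ (if does (v H.≟ α (part (proj₁ v))) then v else w))

        αEnd-left : ∀ z w → αEnd (α z) w ≡ z
        αEnd-left z w rewrite part-α z | dec-true (α z H.≟ α z) ≡.refl = part-α z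

        αEnd-right : ∀ v z → v H.~ α z → αEnd v (α z) ≡ z
        αEnd-right v z v~αz
          rewrite dec-false (v H.≟ α (part (proj₁ v)))
                    (λ v≡α → α-independent (part (proj₁ v)) z (≡.subst (H._~ α z) v≡α v~αz)) = part-α z

        αEnds : Fin (size S) → Fin m ⊎ Fin n
        αEnds k = αEnd (endpoint₁ S k) (endpoint₂ S k)

        αEnds-cover : ∀ {z w} → S ∋ α z — w → ∃[ k ] αEnds k ≡ z
        αEnds-cover {z} {w} e with endpoints-surjective S e
        ... | k , inj₁ (eq₁ , eq₂) = k , ≡.trans (≡.cong₂ αEnd eq₁ eq₂) (αEnd-left z w)
        ... | k , inj₂ (eq₁ , eq₂) = k , ≡.trans (≡.cong₂ αEnd eq₁ eq₂)
                                           (αEnd-right w z (H.~-sym (member⇒~ S e)))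

        module _ (p : Vector Carrier m) (vanishes : ∀ k → u p (αEnds k) ≈ 0#) where
          Support : H.V → Set ℓ₂
          Support v = ∃[ z ] v ≡ α z × u p z # 0#

          support-independent : ∀ {v w} → Support v → Support w → ¬ (v H.~ w)
          support-independent (z , ≡.refl , _) (z′ , ≡.refl , _) = α-independent z z′

          support-avoids : ∀ v w → Support v → ¬ (S ∋ v — w)
          support-avoids _ _ (z , ≡.refl , u#0) e with k , ≡.refl ← αEnds-cover e =
            ¬0#0 (#-congʳ (vanishes k) u#0)

          -- The mate of a row vertex is a column vertex, and `another` finds a second row of the
          -- support adjacent to that column.
          support-step : ∀ {v} → Support v → ∃[ v′ ] v′ ≢ v × Support v′ × v′ H.~ mate v
          support-step {v} (z , ≡.refl , u#0) with colour (mate v)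
          ... | inj₁ w≡α = contradiction (≡.subst (v H.~_) w≡α (mate-~ v))
                             (α-independent z (part (proj₁ (mate v))))
          ... | inj₂ w≡β =
            let z″ , z″≢z , u″#0 , adj = another p z (part (proj₁ (mate v))) u#0
                                       (≡.subst (v H.~_) w≡β (mate-~ v))
            in α z″ , (λ eq → z″≢z (≡.trans (≡.sym (part-α z″)) (≡.trans (≡.cong (part ∘ proj₁) eq) (part-α z))))
             , (z″ , ≡.refl , u″#0) , ≡.subst (α z″ H.~_) (≡.sym w≡β) adj

        -- Vanishing of `u` on the rows met by `S` imposes `size S` linear conditions on `p`. With
        -- fewer than `m` of them a nonzero `p` survives, and its support is inhabited, against
        -- `P-empty`. The goal is a negation, so the double negations can be discharged.
        m≤size : m ≤ size S
        m≤size = ℕ.≮⇒≥ λ s<m → kernel-nontrivial s<m (weight ∘ αEnds) λ where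
          (p , (i , pᵢ#0) , vanishes) → ¬¬-∀-dec H.index (Support p vanishes) λ support? →
            AlternatingCycle.P-empty {M = M} {S} pm forcing support?
              (support-independent p vanishes) (λ {v} {w} → support-avoids p vanishes v w)
              (support-step p vanishes)
              (α (inj₁ i)) (inj₁ i , ≡.refl , #-congʳ (sym (u-X p i)) pᵢ#0)

-- The forcing number of the prism

theorem3p1 : ∀ {c ℓ₁ ℓ₂} (F : HeytingField c ℓ₁ ℓ₂) (G : Graph) (m n : ℕ) (P : Bipartition G m n) →
    m ≤ n → Satisfiable (𝓡 F P) → IsForcingNumber (G □ K 2) m
theorem3p1 F G m n P _ (B , B-weighted , C , C-weighted , BCᵀ≈I) =
  -- The bound `m≤size` holds for every perfect matching. It serves for the exact size of
  -- `X-fibres`, for minimality within `fibres`, and for minimality over all matchings.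
  (fibres , fibres-isPerfectMatching
    , (X-fibres , X-fibres-forcing
        , ℕ.≤-antisym X-fibres-size (m≤size {fibres} {X-fibres} fibres-isPerfectMatching X-fibres-forcing))
    , λ { _ (S , forcing , ≡.refl) → m≤size {fibres} {S} fibres-isPerfectMatching forcing })
  , λ { _ (M , pm , (S , forcing , ≡.refl) , _) → m≤size {M} {S} pm forcing }
  where
  open Bipartition P
  open LinearAlgebra F using (Carrier; _≈_; _#_; 0#; 1#; _·_; trans; reflexive)

  x_ : Fin m → X
  x_ = Inverse.from X-index

  y_ : Fin n → Y
  y_ = Inverse.from Y-index

  place : (Fin m ⊎ Fin n) ↔ Graph.V G
  place = parts ↔-∘ ↔-sym (X-index ⊎-↔ Y-index)

  X-independent : ∀ i i′ → ¬ Graph._~_ G (xᵥ (x_ i)) (xᵥ (x_ i′))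
  X-independent i i′ = X-indep (x_ i) (x_ i′)

  Y-independent : ∀ j j′ → ¬ Graph._~_ G (yᵥ (y_ j)) (yᵥ (y_ j′))
  Y-independent j j′ = Y-indep (y_ j) (y_ j′)

  B′ C′ : Fin m → Vector Carrier n
  B′ i j = B (x_ i) (y_ j)
  C′ i j = C (x_ i) (y_ j)

  B′-weighted : ∀ i j → (B′ i j # 0#) ⇔ Graph._~_ G (xᵥ (x_ i)) (yᵥ (y_ j))
  B′-weighted i j = B-weighted (x_ i) (y_ j)

  C′-weighted : ∀ i j → (C′ i j # 0#) ⇔ Graph._~_ G (xᵥ (x_ i)) (yᵥ (y_ j))
  C′-weighted i j = C-weighted (x_ i) (y_ j)

  B′C′ᵀ-diagonal : ∀ i → B′ i · C′ i ≈ 1#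
  B′C′ᵀ-diagonal i = trans (BCᵀ≈I (x_ i) (x_ i)) (reflexive (≡.cong (if_then 1# else 0#)
    (dec-true (finite⇒≟ X-index (x_ i) (x_ i)) ≡.refl)))

  B′C′ᵀ-off : ∀ {i i′} → i ≢ i′ → B′ i · C′ i′ ≈ 0#
  B′C′ᵀ-off {i} {i′} i≢i′ = trans (BCᵀ≈I (x_ i) (x_ i′)) (reflexive (≡.cong (if_then 1# else 0#)
    (dec-false (finite⇒≟ X-index (x_ i) (x_ i′))
      (i≢i′ ∘ Injection.injective (↔⇒↣ (↔-sym X-index))))))

  open Prism {G} place X-independent Y-independent
  open LowerBound.Weighted F B′ C′ B′-weighted C′-weighted B′C′ᵀ-diagonal B′C′ᵀ-off
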